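{- There is an absolute constant $C>0$ such that for every positive integer $\ell$, every $P_5$-free graph that does not contain $K_{\ell,\ell}$ as a (not necessarily induced) subgraph has degeneracy at most $C\,\ell^{3}$.
   Context: All graphs are finite, simple and undirected. $P_5$ is the path on $5$ vertices. A graph $G$ is $H$-free if it has no induced subgraph isomorphic to $H$. $K_{\ell,\ell}$ is the complete bipartite graph with $\ell$ vertices on each side. A graph is $d$-degenerate if every (nonempty) induced subgraph contains a vertex of degree at most $d$ in that subgraph; the degeneracy of $G$ is the minimum $d\geq 0$ for which $G$ is $d$-degenerate. -}

module Defs where

open import Data.Fin.Base using (Fin; toℕ)
open import Data.Fin.Properties using (any?)
open import Data.Fin.Subset using (Subset; _∈_; _∩_; ∣_∣; Nonempty)
open import Data.Fin.Subset.Properties using (anySubset?; nonempty?; _∈?_; ∣p∣≤n)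
open import Data.Nat.Base using (ℕ; zero; suc; _≤_; z≤n; s≤s)
open import Data.Nat.Properties using (_≟_; _≤?_; 1+n≢n)
open import Data.Product.Base using (∃; _×_; _,_; proj₁)
open import Data.Sum.Base using (_⊎_; inj₁; inj₂; swap)
open import Data.Unit.Base using (⊤; tt)
open import Data.Empty using (⊥)
open import Data.Vec.Base using (tabulate)
open import Function.Base using (_∘_)
open import Function.Bundles using (_⇔_)
open import Function.Definitions using (Injective)
open import Level using (0ℓ)
open import Relation.Binary.Core using (Rel)
open import Relation.Binary.Definitions using (Symmetric; Irreflexive; Decidable)
open import Relation.Binary.PropositionalEquality using (_≡_; refl)
open import Relation.Nullary using (¬_; Dec; yes; no; does; contradiction)
open import Relation.Nullary.Decidable
  using (map′; ¬?; _×-dec_; _⊎-dec_; decidable-stable)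
open import Relation.Unary using (Pred) renaming (Decidable to Decidable₁)

record Graph (V : Set) : Set₁ where
  field
    Adj        : Rel V 0ℓ
    Adj-sym    : Symmetric Adj
    Adj-irrefl : Irreflexive _≡_ Adj
    Adj?       : Decidable Adj

open Graph

record _InducedIn_ {V W : Set} (H : Graph V) (G : Graph W) : Set where
  field
    embed     : V → W
    injective : Injective _≡_ _≡_ embed
    adjacency : ∀ u v → Adj H u v ⇔ Adj G (embed u) (embed v)

record _ContainedIn_ {V W : Set} (H : Graph V) (G : Graph W) : Set where
  field
    embed     : V → W
    injective : Injective _≡_ _≡_ embed
    adjacency : ∀ u v → Adj H u v → Adj G (embed u) (embed v)

_Free_ : {V W : Set} → Graph V → Graph W → Set
H Free G = ¬ (H InducedIn G)

Path : (k : ℕ) → Graph (Fin k)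
Path k .Adj i j = (suc (toℕ i) ≡ toℕ j) ⊎ (suc (toℕ j) ≡ toℕ i)
Path k .Adj-sym = swap
Path k .Adj-irrefl refl (inj₁ eq) = 1+n≢n eq
Path k .Adj-irrefl refl (inj₂ eq) = 1+n≢n eq
Path k .Adj? i j = (suc (toℕ i) ≟ toℕ j) ⊎-dec (suc (toℕ j) ≟ toℕ i)

CompleteBipartite : (a b : ℕ) → Graph (Fin a ⊎ Fin b)
CompleteBipartite a b = record
  { Adj        = A
  ; Adj-sym    = λ {x} {y} → A-sym x y
  ; Adj-irrefl = λ {x} {y} → A-irrefl x y
  ; Adj?       = A?
  }
  where
  A : Rel (Fin a ⊎ Fin b) 0ℓ
  A (inj₁ _) (inj₁ _) = ⊥
  A (inj₁ _) (inj₂ _) = ⊤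
  A (inj₂ _) (inj₁ _) = ⊤
  A (inj₂ _) (inj₂ _) = ⊥

  A-sym : ∀ x y → A x y → A y x
  A-sym (inj₁ _) (inj₂ _) _ = tt
  A-sym (inj₂ _) (inj₁ _) _ = tt

  A-irrefl : ∀ x y → x ≡ y → ¬ A x y
  A-irrefl (inj₁ _) _ refl ()
  A-irrefl (inj₂ _) _ refl ()

  A? : ∀ x y → Dec (A x y)
  A? (inj₁ _) (inj₁ _) = no λ ()
  A? (inj₁ _) (inj₂ _) = yes tt
  A? (inj₂ _) (inj₁ _) = yes tt
  A? (inj₂ _) (inj₂ _) = no λ ()

module _ {n : ℕ} (G : Graph (Fin n)) where

  neighbours : Fin n → Subset n
  neighbours v = tabulate (λ u → does (Adj? G v u))

  -- For v ∈ S, this is the degree of v in the subgraph of G induced by S.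
  degreeIn : Subset n → Fin n → ℕ
  degreeIn S v = ∣ neighbours v ∩ S ∣

  Degenerate : ℕ → Set
  Degenerate d = ∀ S → Nonempty S → ∃ λ v → v ∈ S × degreeIn S v ≤ d

  IsDegeneracy : ℕ → Set
  IsDegeneracy d = Degenerate d × (∀ e → Degenerate e → d ≤ e)

  degenerate? : Decidable₁ Degenerate
  degenerate? d = map′
    (λ ¬bad S ne → decidable-stable (low? S) λ ¬low → ¬bad (S , ne , ¬low))
    (λ { deg (S , ne , ¬low) → ¬low (deg S ne) })
    (¬? (anySubset? λ S → nonempty? S ×-dec ¬? (low? S)))
    where
    low? : ∀ S → Dec (∃ λ v → v ∈ S × degreeIn S v ≤ d)
    low? S = any? λ v → (v ∈? S) ×-dec (degreeIn S v ≤? d)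

  degenerate-order : Degenerate n
  degenerate-order S (v , v∈S) = v , v∈S , ∣p∣≤n (neighbours v ∩ S)

least : {P : Pred ℕ 0ℓ} → Decidable₁ P → ∀ m → P m →
        ∃ λ d → P d × (∀ e → P e → d ≤ e)
least P? zero    p = zero , p , λ _ _ → z≤n
least P? (suc m) p with P? zero
... | yes p₀ = zero , p₀ , λ _ _ → z≤n
... | no ¬p₀ with least (P? ∘ suc) m p
...   | d , pd , min = suc d , pd , λ
        { zero    p₀ → contradiction p₀ ¬p₀
        ; (suc e) pe → s≤s (min e pe)
        }

hasDegeneracy : ∀ {n} (G : Graph (Fin n)) → ∃ (IsDegeneracy G)
hasDegeneracy {n} G = least (degenerate? G) n (degenerate-order G)

degeneracy : ∀ {n} → Graph (Fin n) → ℕ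
degeneracy G = proj₁ (hasDegeneracy G)

{-# OPTIONS --safe #-}
-- Let u have minimum degree d > 3ℓ³ in an induced subgraph, let N be its
-- neighbourhood, and let A v be the set of neighbours of v outside N.  If
-- v, b ∈ N are nonadjacent, x ∈ A v ─ A b and y ∈ A b ─ A v, then x and y are
-- adjacent, as otherwise y b u v x is an induced path; so of the two
-- differences the smaller has fewer than ℓ elements.  Call v ∈ N bad if it
-- misses at most ℓ² + ℓ vertices of N: there are fewer than ℓ bad vertices, as
-- ℓ of them would have ℓ common neighbours in N.  Choose v not bad with ∣A v∣
-- minimal.  It misses at least ℓ vertices of N that are not bad, and each of
-- these misses fewer than ℓ vertices of A v.  Since d is minimum,
-- ∣A v∣ ≥ ∣N ─ N(v)∣ > ℓ² + ℓ, so ℓ of them have ℓ common neighbours in A v.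
module Submission where

open import Defs
open import Data.Nat.Base using (ℕ; zero; suc; _+_; _*_; _^_; _≤_; _<_; _>_; s≤s; z<s; >-nonZero)
open import Data.Nat.Properties
  using ( _≤?_; ≤-refl; ≤-reflexive; ≤-trans; <⇒≤; ≰⇒>; +-assoc; +-comm; +-suc; +-mono-≤
        ; +-monoʳ-≤; +-monoˡ-≤; +-cancelˡ-≤; +-cancelʳ-≤; *-distribˡ-+; *-monoʳ-≤
        ; m≤m+n; m≤m*n; module ≤-Reasoning)
open import Data.Nat.Tactic.RingSolver using (solve-∀)
open import Data.Fin.Base as Fin using (Fin; zero; suc)
open import Data.Fin.Properties as Fin using (any?; all?; suc-injective)
open import Data.Fin.Subset using (Subset; inside; outside; _∈_; _∉_; _⊆_; _∩_; _─_; ∣_∣; Nonempty)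
open import Data.Fin.Subset.Properties
  using (_∈?_; ∩-comm; p∩q⊆p; p∩q⊆q; x∈p∩q⁺; p⊆q⇒∣p∣≤∣q∣; p─q⊆p; x∈p∧x∉q⇒x∈p─q)
open import Data.Product.Base using (∃; _×_; _,_; proj₁; proj₂)
open import Data.Sum.Base using (inj₁; inj₂; [_,_])
open import Data.Vec.Base using (_∷_; []; lookup; tabulate; here; there)
open import Data.Vec.Properties using (lookup∘tabulate; []=⇒lookup; lookup⇒[]=)
open import Function.Base using (_∘_)
open import Function.Bundles using (_⇔_; mk⇔; Equivalence)
open import Function.Definitions using (Injective)
open import Level using (0ℓ)
open import Relation.Binary.Definitions using (tri<; tri≈; tri>)
open import Relation.Binary.PropositionalEquality using (_≡_; refl; sym; trans; cong; subst)
open import Relation.Nullary using (¬_; yes; no; does; contradiction)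
open import Relation.Nullary.Decidable using (dec-true; from-yes; _×-dec_; _→-dec_)
open import Relation.Unary using (Pred; Decidable)

open Graph
open Equivalence using (to; from)

private variable
  n : ℕ

-- Counting in finite subsets

x∈p─q⇒x∉q : ∀ {x} (p q : Subset n) → x ∈ p ─ q → x ∉ q
x∈p─q⇒x∉q (_ ∷ p) (outside ∷ q) (there x∈p─q) (there x∈q) = x∈p─q⇒x∉q p q x∈p─q x∈q
x∈p─q⇒x∉q (_ ∷ p) (inside  ∷ q) (there x∈p─q) (there x∈q) = x∈p─q⇒x∉q p q x∈p─q x∈q

∣p∣≡∣p∩q∣+∣p─q∣ : (p q : Subset n) → ∣ p ∣ ≡ ∣ p ∩ q ∣ + ∣ p ─ q ∣
∣p∣≡∣p∩q∣+∣p─q∣ []            []            = refl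
∣p∣≡∣p∩q∣+∣p─q∣ (outside ∷ p) (outside ∷ q) = ∣p∣≡∣p∩q∣+∣p─q∣ p q
∣p∣≡∣p∩q∣+∣p─q∣ (outside ∷ p) (inside  ∷ q) = ∣p∣≡∣p∩q∣+∣p─q∣ p q
∣p∣≡∣p∩q∣+∣p─q∣ (inside  ∷ p) (inside  ∷ q) = cong suc (∣p∣≡∣p∩q∣+∣p─q∣ p q)
∣p∣≡∣p∩q∣+∣p─q∣ (inside  ∷ p) (outside ∷ q) =
  trans (cong suc (∣p∣≡∣p∩q∣+∣p─q∣ p q)) (sym (+-suc _ _))

-- Both sets split off the same intersection, which cancels.
∣p∣≤∣q∣⇒∣p─q∣≤∣q─p∣ : (p q : Subset n) → ∣ p ∣ ≤ ∣ q ∣ → ∣ p ─ q ∣ ≤ ∣ q ─ p ∣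
∣p∣≤∣q∣⇒∣p─q∣≤∣q─p∣ p q ∣p∣≤∣q∣ = +-cancelˡ-≤ ∣ p ∩ q ∣ _ _ (begin
  ∣ p ∩ q ∣ + ∣ p ─ q ∣  ≡⟨ ∣p∣≡∣p∩q∣+∣p─q∣ p q ⟨
  ∣ p ∣                  ≤⟨ ∣p∣≤∣q∣ ⟩
  ∣ q ∣                  ≡⟨ ∣p∣≡∣p∩q∣+∣p─q∣ q p ⟩
  ∣ q ∩ p ∣ + ∣ q ─ p ∣  ≡⟨ cong (λ r → ∣ r ∣ + ∣ q ─ p ∣) (∩-comm q p) ⟩
  ∣ p ∩ q ∣ + ∣ q ─ p ∣  ∎)
  where open ≤-Reasoning

∣p∣≤∣q∣+∣p─q∣ : (p q : Subset n) → ∣ p ∣ ≤ ∣ q ∣ + ∣ p ─ q ∣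
∣p∣≤∣q∣+∣p─q∣ p q = begin
  ∣ p ∣                  ≡⟨ ∣p∣≡∣p∩q∣+∣p─q∣ p q ⟩
  ∣ p ∩ q ∣ + ∣ p ─ q ∣  ≤⟨ +-monoˡ-≤ _ (p⊆q⇒∣p∣≤∣q∣ (p∩q⊆q p q)) ⟩
  ∣ q ∣ + ∣ p ─ q ∣      ∎
  where open ≤-Reasoning

enumerate : ∀ k (p : Subset n) → k ≤ ∣ p ∣ →
            ∃ λ (f : Fin k → Fin n) → Injective _≡_ _≡_ f × (∀ i → f i ∈ p)
enumerate zero    p             _     = (λ ()) , (λ { {()} }) , λ ()
enumerate (suc k) (outside ∷ p) k≤∣p∣ =
  let f , f-inj , f∈p = enumerate (suc k) p k≤∣p∣
  in  suc ∘ f , f-inj ∘ suc-injective , there ∘ f∈p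
enumerate (suc k) (inside ∷ p) (s≤s k≤∣p∣) =
  let f , f-inj , f∈p = enumerate k p k≤∣p∣
  in  (λ { zero → zero ; (suc i) → suc (f i) })
    , (λ { {zero} {zero} _ → refl
         ; {suc i} {suc j} eq → cong suc (f-inj (suc-injective eq)) })
    , λ { zero → here ; (suc i) → there (f∈p i) }

0<∣p∣⇒Nonempty : (p : Subset n) → 0 < ∣ p ∣ → Nonempty p
0<∣p∣⇒Nonempty p 0<∣p∣ = let f , _ , f∈p = enumerate 1 p 0<∣p∣ in f zero , f∈p zero

-- `least` finds the smallest `d` such that some element of `p` has value at most `d`; the element
-- found there is a minimiser.
∃-minimiser : (p : Subset n) (f : Fin n → ℕ) → Nonempty p →
              ∃ λ v → v ∈ p × (∀ w → w ∈ p → f v ≤ f w)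
∃-minimiser p f (x , x∈p) =
  let d , (v , v∈p , fv≤d) , d-min =
        least (λ d → any? λ v → (v ∈? p) ×-dec (f v ≤? d)) (f x) (x , x∈p , ≤-refl)
  in  v , v∈p , λ w w∈p → ≤-trans fv≤d (d-min (f w) (w , w∈p , ≤-refl))

module _ {P : Pred (Fin n) 0ℓ} (P? : Decidable P) where

  -- Encoded in the same way as `neighbours`, so that `P⇒∈` and `∈⇒P` apply to neighbourhoods
  -- directly.
  ⟦_⟧ : Subset n
  ⟦_⟧ = tabulate (does ∘ P?)

  P⇒∈ : ∀ {x} → P x → x ∈ ⟦_⟧
  P⇒∈ {x} px = lookup⇒[]= x _ (trans (lookup∘tabulate (does ∘ P?) x) (dec-true (P? x) px))

  ∈⇒P : ∀ {x} → x ∈ ⟦_⟧ → P x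
  ∈⇒P {x} x∈ with P? x | trans (sym (lookup∘tabulate (does ∘ P?) x)) ([]=⇒lookup x∈)
  ... | yes px | _  = px
  ... | no  _  | ()

-- Induced paths on five vertices

twin-free-P₅ : ∀ i j →
  (∀ k → (Adj (Path 5) i k → Adj (Path 5) j k) × (Adj (Path 5) j k → Adj (Path 5) i k)) → i ≡ j
twin-free-P₅ = from-yes (all? λ i → all? λ j →
  (all? λ k → (Adj? (Path 5) i k →-dec Adj? (Path 5) j k)
        ×-dec (Adj? (Path 5) j k →-dec Adj? (Path 5) i k))
  →-dec (i Fin.≟ j))

module _ (G : Graph (Fin n)) where

  ∈-neighbours⁺ : ∀ {u v} → Adj G u v → v ∈ neighbours G u
  ∈-neighbours⁺ {u} = P⇒∈ (Adj? G u)

  ∈-neighbours⁻ : ∀ {u v} → v ∈ neighbours G u → Adj G u v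
  ∈-neighbours⁻ {u} = ∈⇒P (Adj? G u)

  -- The four edges and five nonedges given settle every pair except the ends; if these were
  -- nonadjacent too, `a b c d e` would be an induced path.
  P₅-free⇒ends-adjacent : Path 5 Free G → ∀ {a b c d e} →
    Adj G a b → Adj G b c → Adj G c d → Adj G d e →
    ¬ Adj G a c → ¬ Adj G a d → ¬ Adj G b d →
    ¬ Adj G b e → ¬ Adj G c e → Adj G a e
  P₅-free⇒ends-adjacent free {a} {b} {c} {d} {e} ab bc cd de ¬ac ¬ad ¬bd ¬be ¬ce
    with Adj? G a e
  ... | yes ae = ae
  ... | no ¬ae = contradiction record { embed = p ; injective = p-injective ; adjacency = adj } free
    where
    p : Fin 5 → Fin n
    p = lookup (a ∷ b ∷ c ∷ d ∷ e ∷ [])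

    edge : ∀ {i j} → Adj (Path 5) i j → Adj G (p i) (p j) → Adj (Path 5) i j ⇔ Adj G (p i) (p j)
    edge ij g = mk⇔ (λ _ → g) (λ _ → ij)

    nonedge : ∀ {i j} → ¬ Adj G (p i) (p j) → ¬ Adj (Path 5) i j → Adj (Path 5) i j ⇔ Adj G (p i) (p j)
    nonedge ¬g ¬ij = mk⇔ (λ ij → contradiction ij ¬ij) (λ g → contradiction g ¬g)

    upper : ∀ i j → i Fin.< j → Adj (Path 5) i j ⇔ Adj G (p i) (p j)
    upper zero                   (suc zero)                   _ = edge (inj₁ refl) ab
    upper zero                   (suc (suc zero))             _ = nonedge ¬ac λ { (inj₁ ()) ; (inj₂ ()) }
    upper zero                   (suc (suc (suc zero)))       _ = nonedge ¬ad λ { (inj₁ ()) ; (inj₂ ()) }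
    upper zero                   (suc (suc (suc (suc zero)))) _ = nonedge ¬ae λ { (inj₁ ()) ; (inj₂ ()) }
    upper (suc zero)             (suc (suc zero))             _ = edge (inj₁ refl) bc
    upper (suc zero)             (suc (suc (suc zero)))       _ = nonedge ¬bd λ { (inj₁ ()) ; (inj₂ ()) }
    upper (suc zero)             (suc (suc (suc (suc zero)))) _ = nonedge ¬be λ { (inj₁ ()) ; (inj₂ ()) }
    upper (suc (suc zero))       (suc (suc (suc zero)))       _ = edge (inj₁ refl) cd
    upper (suc (suc zero))       (suc (suc (suc (suc zero)))) _ = nonedge ¬ce λ { (inj₁ ()) ; (inj₂ ()) }
    upper (suc (suc (suc zero))) (suc (suc (suc (suc zero)))) _ = edge (inj₁ refl) de
    upper (suc _)                      (suc zero)                         (s≤s ())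
    upper (suc (suc _))                (suc (suc zero))                   (s≤s (s≤s ()))
    upper (suc (suc (suc _)))          (suc (suc (suc zero)))             (s≤s (s≤s (s≤s ())))
    upper (suc (suc (suc (suc zero)))) (suc (suc (suc (suc zero))))       (s≤s (s≤s (s≤s (s≤s ()))))

    adj : ∀ i j → Adj (Path 5) i j ⇔ Adj G (p i) (p j)
    adj i j with Fin.<-cmp i j
    ... | tri< i<j _ _  = upper i j i<j
    ... | tri≈ _ refl _ = nonedge {i} (Adj-irrefl G refl) (Adj-irrefl (Path 5) {i} refl)
    ... | tri> _ _ j<i  = mk⇔ (λ ij → Adj-sym G (to (upper j i j<i) (Adj-sym (Path 5) {i} {j} ij)))
                              (λ g → Adj-sym (Path 5) {j} {i} (from (upper j i j<i) (Adj-sym G g)))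

    p-injective : Injective _≡_ _≡_ p
    -- Distinctness comes from adjacency alone: path vertices with equal images have equal
    -- neighbourhoods in the path, and no two vertices of P₅ do.
    p-injective {i} {j} pi≡pj = twin-free-P₅ i j λ k →
      (λ ik → from (adj j k) (subst (λ x → Adj G x (p k)) pi≡pj (to (adj i k) ik))) ,
      (λ jk → from (adj i k) (subst (λ x → Adj G x (p k)) (sym pi≡pj) (to (adj j k) jk)))

  -- Bicliques from common neighbours

  complete⇒biclique : ∀ {a b} (f : Fin a → Fin n) (g : Fin b → Fin n) →
    Injective _≡_ _≡_ f → Injective _≡_ _≡_ g → (∀ i j → Adj G (f i) (g j)) →
    CompleteBipartite a b ContainedIn G
  complete⇒biclique f g f-inj g-inj complete = record
    { embed     = [ f , g ]
    ; injective = λ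
        { {inj₁ i} {inj₁ j} eq → cong inj₁ (f-inj eq)
        ; {inj₁ i} {inj₂ j} eq → contradiction (complete i j) (Adj-irrefl G eq)
        ; {inj₂ i} {inj₁ j} eq → contradiction (complete j i) (Adj-irrefl G (sym eq))
        ; {inj₂ i} {inj₂ j} eq → cong inj₂ (g-inj eq)
        }
    ; adjacency = λ where
        (inj₁ i) (inj₂ j) _ → complete i j
        (inj₂ i) (inj₁ j) _ → Adj-sym G (complete j i)
    }

  -- Intersecting `T` with the neighbourhoods one at a time loses at most `k` elements at each step.
  ∃-common-neighbours : ∀ {k} j (f : Fin j → Fin n) (T : Subset n) →
    (∀ i → ∣ T ─ neighbours G (f i) ∣ ≤ k) →
    ∃ λ Q → Q ⊆ T × (∀ i {y} → y ∈ Q → Adj G (f i) y) × ∣ T ∣ ≤ ∣ Q ∣ + j * k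
  ∃-common-neighbours     zero    f T few = T , (λ x → x) , (λ ()) , m≤m+n _ _
  ∃-common-neighbours {k} (suc j) f T few =
    let Q , Q⊆T , adjacent , ∣T∣≤ = ∃-common-neighbours j (f ∘ suc) T (few ∘ suc)
        N = neighbours G (f zero)
        Q─N⊆T─N : Q ─ N ⊆ T ─ N
        Q─N⊆T─N x∈ = x∈p∧x∉q⇒x∈p─q (Q⊆T (p─q⊆p Q N x∈)) (x∈p─q⇒x∉q Q N x∈)
        open ≤-Reasoning
    in  Q ∩ N
      , Q⊆T ∘ p∩q⊆p Q N
      , (λ { zero y∈ → ∈-neighbours⁻ (p∩q⊆q Q N y∈)
           ; (suc i) y∈ → adjacent i (p∩q⊆p Q N y∈) })
      , (begin
          ∣ T ∣                            ≤⟨ ∣T∣≤ ⟩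
          ∣ Q ∣ + j * k                    ≡⟨ cong (_+ j * k) (∣p∣≡∣p∩q∣+∣p─q∣ Q N) ⟩
          ∣ Q ∩ N ∣ + ∣ Q ─ N ∣ + j * k    ≡⟨ +-assoc ∣ Q ∩ N ∣ _ _ ⟩
          ∣ Q ∩ N ∣ + (∣ Q ─ N ∣ + j * k)  ≤⟨ +-monoʳ-≤ ∣ Q ∩ N ∣ (+-monoˡ-≤ (j * k)
                                                (≤-trans (p⊆q⇒∣p∣≤∣q∣ Q─N⊆T─N) (few zero))) ⟩
          ∣ Q ∩ N ∣ + (k + j * k)          ∎)

  -- Any `a` vertices of `P` together miss at most `a * k` elements of `T`, so `b` common neighbours
  -- remain.
  few-nonneighbours⇒biclique : ∀ a b k (P T : Subset n) → a ≤ ∣ P ∣ → b + a * k ≤ ∣ T ∣ →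
    (∀ v → v ∈ P → ∣ T ─ neighbours G v ∣ ≤ k) → CompleteBipartite a b ContainedIn G
  few-nonneighbours⇒biclique a b k P T a≤∣P∣ ≤∣T∣ few =
    let f , f-inj , f∈P = enumerate a P a≤∣P∣
        Q , _ , adjacent , ∣T∣≤ = ∃-common-neighbours a f T (λ i → few (f i) (f∈P i))
        g , g-inj , g∈Q = enumerate b Q (+-cancelʳ-≤ (a * k) b ∣ Q ∣ (≤-trans ≤∣T∣ ∣T∣≤))
    in  complete⇒biclique f g f-inj g-inj (λ i j → adjacent i (g∈Q j))

  -- Neighbours outside the neighbourhood of a fixed vertex

  module _ {ℓ : ℕ} (P₅-free : Path 5 Free G)
           (no-biclique : ¬ (CompleteBipartite ℓ ℓ ContainedIn G)) (S : Subset n) where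

    private
      N : Fin n → Subset n
      N v = neighbours G v ∩ S

    -- For v adjacent to u this contains u itself, so that v ∈ N u ─ N v is balanced by u.
    outer : Fin n → Fin n → Subset n
    outer u v = N v ─ N u

    ∈N⁻ : ∀ {u v} → v ∈ N u → Adj G u v
    ∈N⁻ = ∈-neighbours⁻ ∘ p∩q⊆p _ S

    ∈outer⁺ : ∀ {u v x} → x ∈ S → Adj G v x → ¬ Adj G u x → x ∈ outer u v
    ∈outer⁺ x∈S vx ¬ux = x∈p∧x∉q⇒x∈p─q (x∈p∩q⁺ (∈-neighbours⁺ vx , x∈S)) (¬ux ∘ ∈N⁻)

    ∈outer⁻ : ∀ {u v x} → x ∈ outer u v → x ∈ S × Adj G v x × ¬ Adj G u x
    ∈outer⁻ {u} {v} x∈ =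
      x∈S , ∈N⁻ x∈Nv , λ ux → x∈p─q⇒x∉q (N v) (N u) x∈ (x∈p∩q⁺ (∈-neighbours⁺ ux , x∈S))
      where
      x∈Nv = p─q⊆p (N v) (N u) x∈
      x∈S  = p∩q⊆q _ S x∈Nv

    -- `X` is no larger than `Y` and complete to it, so `ℓ` elements of `X` would give a biclique.
    -- Removing `neighbours G b` rather than `outer u b` gives the form that
    -- `few-nonneighbours⇒biclique` takes.
    outer-nearly-nested : ∀ {u v b} → Adj G u v → Adj G u b → ¬ Adj G v b →
      ∣ outer u v ∣ ≤ ∣ outer u b ∣ → ∣ outer u v ─ neighbours G b ∣ < ℓ
    outer-nearly-nested {u} {v} {b} uv ub ¬vb ∣v∣≤∣b∣ = ≰⇒> λ ℓ≤∣X∣ →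
      let f , f-inj , f∈X = enumerate ℓ X ℓ≤∣X∣
          g , g-inj , g∈Y = enumerate ℓ Y (≤-trans ℓ≤∣X∣ ∣X∣≤∣Y∣)
      in  no-biclique (complete⇒biclique f g f-inj g-inj λ i j → X-complete-to-Y (f∈X i) (g∈Y j))
      where
      X = outer u v ─ neighbours G b
      Y = outer u b ─ outer u v

      X⊆ : X ⊆ outer u v ─ outer u b
      X⊆ x∈X = x∈p∧x∉q⇒x∈p─q (p─q⊆p _ _ x∈X) λ x∈b →
        x∈p─q⇒x∉q (outer u v) (neighbours G b) x∈X (∈-neighbours⁺ (proj₁ (proj₂ (∈outer⁻ x∈b))))

      ∣X∣≤∣Y∣ : ∣ X ∣ ≤ ∣ Y ∣
      ∣X∣≤∣Y∣ = ≤-trans (p⊆q⇒∣p∣≤∣q∣ X⊆) (∣p∣≤∣q∣⇒∣p─q∣≤∣q─p∣ (outer u v) (outer u b) ∣v∣≤∣b∣)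

      X-complete-to-Y : ∀ {x y} → x ∈ X → y ∈ Y → Adj G x y
      X-complete-to-Y x∈X y∈Y =
        let _ , vx , ¬ux   = ∈outer⁻ (p─q⊆p _ _ x∈X)
            y∈S , by , ¬uy = ∈outer⁻ (p─q⊆p _ _ y∈Y)
            ¬bx = x∈p─q⇒x∉q (outer u v) (neighbours G b) x∈X ∘ ∈-neighbours⁺
            ¬vy = λ vy → x∈p─q⇒x∉q (outer u b) (outer u v) y∈Y (∈outer⁺ y∈S vy ¬uy)
        -- The path is `x v u b y`.
        in  P₅-free⇒ends-adjacent P₅-free
              (Adj-sym G vx) (Adj-sym G uv) ub by
              (¬ux ∘ Adj-sym G) (¬bx ∘ Adj-sym G) ¬vb ¬vy ¬uy

    -- Bounding the minimum degree

    module _ {u : Fin n} (u-min : ∀ w → w ∈ S → ∣ N u ∣ ≤ ∣ N w ∣) where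

      -- By minimality `v` has at least the degree of `u`, so what it misses inside `N u` it makes
      -- up for outside.
      ∣N─neighbours∣≤∣outer∣ : ∀ {v} → v ∈ S → ∣ N u ─ neighbours G v ∣ ≤ ∣ outer u v ∣
      ∣N─neighbours∣≤∣outer∣ {v} v∈S =
        ≤-trans (p⊆q⇒∣p∣≤∣q∣ ⊆N─N) (∣p∣≤∣q∣⇒∣p─q∣≤∣q─p∣ (N u) (N v) (u-min v v∈S))
        where
        ⊆N─N : N u ─ neighbours G v ⊆ N u ─ N v
        ⊆N─N x∈ = x∈p∧x∉q⇒x∈p─q (p─q⊆p _ _ x∈)
                    (x∈p─q⇒x∉q (N u) (neighbours G v) x∈ ∘ p∩q⊆p _ S)

      -- The bound is the size of `N u` at which `ℓ` vertices, each missing at most `m` of its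
      -- elements, are sure to have `ℓ` common neighbours there.
      min-degree< : ℓ > 0 → ∣ N u ∣ < ℓ + ℓ * (ℓ + ℓ * ℓ)
      min-degree< ℓ>0 = ≰⇒> λ large →
        let
          ∣Bad∣<ℓ : ∣ Bad ∣ < ℓ
          ∣Bad∣<ℓ = ≰⇒> λ ℓ≤∣Bad∣ → no-biclique
            (few-nonneighbours⇒biclique ℓ ℓ m Bad (N u) ℓ≤∣Bad∣ large
              λ v v∈ → ∈⇒P bad? (p∩q⊆q (N u) _ v∈))

          0<∣Good∣ : 0 < ∣ Good ∣
          0<∣Good∣ = +-cancelˡ-≤ ∣ Bad ∣ 1 _ (begin
            ∣ Bad ∣ + 1         ≡⟨ +-comm ∣ Bad ∣ 1 ⟩
            suc ∣ Bad ∣         ≤⟨ ∣Bad∣<ℓ ⟩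
            ℓ                   ≤⟨ m≤m+n ℓ (ℓ * m) ⟩
            ℓ + ℓ * m           ≤⟨ large ⟩
            ∣ N u ∣             ≤⟨ ∣p∣≤∣q∣+∣p─q∣ (N u) Bad ⟩
            ∣ Bad ∣ + ∣ Good ∣  ∎)

          v , v∈Good , v-min = ∃-minimiser Good (λ w → ∣ outer u w ∣) (0<∣p∣⇒Nonempty Good 0<∣Good∣)

          v∈N = p─q⊆p (N u) Bad v∈Good

          m<∣missed∣ : m < ∣ N u ─ neighbours G v ∣
          m<∣missed∣ = ≰⇒> λ v-bad →
            x∈p─q⇒x∉q (N u) Bad v∈Good (x∈p∩q⁺ (v∈N , P⇒∈ bad? v-bad))

          missed = N u ─ neighbours G v
          P      = missed ─ Bad

          ℓ≤∣P∣ : ℓ ≤ ∣ P ∣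
          ℓ≤∣P∣ = +-cancelˡ-≤ ℓ ℓ _ (begin
            -- `v` misses at least `2ℓ` vertices, of which fewer than `ℓ` are bad.
            ℓ + ℓ            ≤⟨ +-monoʳ-≤ ℓ (m≤m*n ℓ ℓ {{>-nonZero ℓ>0}}) ⟩
            m                ≤⟨ <⇒≤ m<∣missed∣ ⟩
            ∣ missed ∣       ≤⟨ ∣p∣≤∣q∣+∣p─q∣ missed Bad ⟩
            ∣ Bad ∣ + ∣ P ∣  ≤⟨ +-monoˡ-≤ ∣ P ∣ (<⇒≤ ∣Bad∣<ℓ) ⟩
            ℓ + ∣ P ∣        ∎)

          few : ∀ b → b ∈ P → ∣ outer u v ─ neighbours G b ∣ ≤ ℓ
          few b b∈P =
            let b∈missed = p─q⊆p missed Bad b∈P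
                b∈N      = p─q⊆p (N u) _ b∈missed
                -- `P` leaves out the bad vertices so that the minimality of `v` reaches `b`, making
                -- `outer u v` the smaller of the two outer sets.
                b∈Good   = x∈p∧x∉q⇒x∈p─q b∈N (x∈p─q⇒x∉q missed Bad b∈P)
                ¬vb      = x∈p─q⇒x∉q (N u) (neighbours G v) b∈missed ∘ ∈-neighbours⁺
            in  <⇒≤ (outer-nearly-nested (∈N⁻ v∈N) (∈N⁻ b∈N) ¬vb (v-min b b∈Good))
        in
        no-biclique (few-nonneighbours⇒biclique ℓ ℓ ℓ P (outer u v) ℓ≤∣P∣
          (≤-trans (<⇒≤ m<∣missed∣) (∣N─neighbours∣≤∣outer∣ (p∩q⊆q _ S v∈N))) few)
        where
        open ≤-Reasoning
        -- The threshold for `ℓ` common neighbours in `outer u v` of `ℓ` vertices that each miss at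
        -- most `ℓ` of it.
        m    = ℓ + ℓ * ℓ
        bad? = λ v → ∣ N u ─ neighbours G v ∣ ≤? m
        Bad  = N u ∩ ⟦ bad? ⟧
        Good = N u ─ Bad

-- From the degree bound to degeneracy

cubic-bound : ∀ ℓ → ℓ > 0 → ℓ + ℓ * (ℓ + ℓ * ℓ) ≤ 3 * ℓ ^ 3
cubic-bound ℓ ℓ>0 = begin
  -- The constant 3 counts the terms `ℓ`, `ℓ * ℓ` and `ℓ³`, each at most `ℓ³`.
  ℓ + ℓ * (ℓ + ℓ * ℓ)              ≤⟨ +-mono-≤ (≤-trans ℓ≤ℓ² ℓ²≤ℓ³) (≤-reflexive (*-distribˡ-+ ℓ ℓ (ℓ * ℓ))) ⟩
  ℓ³ + (ℓ * ℓ + ℓ³)                ≤⟨ +-monoʳ-≤ ℓ³ (+-monoˡ-≤ ℓ³ ℓ²≤ℓ³) ⟩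
  ℓ³ + (ℓ³ + ℓ³)                   ≡⟨ three-cubes ℓ ⟩
  3 * ℓ ^ 3                        ∎
  where
  open ≤-Reasoning
  ℓ³ = ℓ * (ℓ * ℓ)
  ℓ≤ℓ² : ℓ ≤ ℓ * ℓ
  ℓ≤ℓ² = m≤m*n ℓ ℓ {{>-nonZero ℓ>0}}
  ℓ²≤ℓ³ : ℓ * ℓ ≤ ℓ³
  ℓ²≤ℓ³ = *-monoʳ-≤ ℓ ℓ≤ℓ²
  three-cubes : ∀ k → k * (k * k) + (k * (k * k) + k * (k * k)) ≡ 3 * (k * (k * (k * 1)))
  three-cubes = solve-∀

theorem2 : ∃ λ (C : ℕ) → C > 0 ×
    (∀ (ℓ : ℕ) → ℓ > 0 → ∀ (n : ℕ) (G : Graph (Fin n)) →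
    Path 5 Free G →
    ¬ (CompleteBipartite ℓ ℓ ContainedIn G) →
    degeneracy G ≤ C * ℓ ^ 3)
theorem2 = 3 , z<s , λ ℓ ℓ>0 n G P₅-free no-biclique →
  -- Degeneracy is the least valid `d`, so it suffices that a vertex of minimum degree in each
  -- nonempty `S` has degree at most `3 * ℓ ^ 3`.
  proj₂ (proj₂ (hasDegeneracy G)) (3 * ℓ ^ 3) λ S S≠∅ →
    let u , u∈S , u-min = ∃-minimiser S (degreeIn G S) S≠∅
    in  u , u∈S , ≤-trans (<⇒≤ (min-degree< G P₅-free no-biclique S u-min ℓ>0)) (cubic-bound ℓ ℓ>0)
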